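{- Let $$a=78771396447102712858983060028364040588200363965800348300294278460171184936676238386812500,$$ $$b=69361450337373409253643736115520077769719726556245843055209221317850552454692640951093751$$ (decimal notation). Then $d(a,b)=6$.
   Context: Let $\mathbb{N}=\{1,2,\ldots\}$. $G$ is the undirected simple graph with vertex set $\mathbb{N}$ in which $x\sim y$ if and only if $|x-y|=1$ or $\max\{x,y\}/\min\{x,y\}$ is a prime number. $d(x,y)$ denotes graph distance in $G$. Each integer is the concatenation of two lines of decimal digits, in order: for $a$ the lines are 787713964471027128589830600283640405882003639658 and 00348300294278460171184936676238386812500; for $b$ the lines are 693614503373734092536437361155200777697197265562 and 45843055209221317850552454692640951093751. -}

module Defs where

open import Data.Nat.Base using (ℕ; zero; suc; NonZero; _*_; _≤_; _⊔_; _⊓_; ∣_-_∣)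
open import Data.Nat.Primality using (Prime; ¬prime[1])
open import Data.Nat.Properties
  using (∣-∣-comm; ⊔-comm; ⊓-comm; ⊔-idem; ⊓-idem; *-cancelʳ-≡; *-identityˡ; ∣n-n∣≡0)
open import Data.Product.Base using (_×_; _,_; ∃-syntax)
open import Data.Sum.Base using (_⊎_; inj₁; inj₂)
import Level
open import Relation.Binary.Core using (Rel)
open import Relation.Binary.Definitions using (Symmetric; Irreflexive)
open import Relation.Binary.PropositionalEquality
  using (_≡_; refl; sym; trans; subst; cong)

-- The positivity proof is irrelevant, so a vertex is determined by its value.
record Vertex : Set where
  constructor vertex
  field
    value        : ℕ
    .{{nonZero}} : NonZero value

open Vertex public using (value)

-- As the values are positive, "max / min is the prime p" is max ≡ p * min.
infix 4 _∼_

_∼_ : Rel Vertex _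
x ∼ y = ∣ value x - value y ∣ ≡ 1
      ⊎ ∃[ p ] Prime p × value x ⊔ value y ≡ p * (value x ⊓ value y)

∼-sym : Symmetric _∼_
∼-sym {x} {y} (inj₁ eq) = inj₁ (trans (∣-∣-comm (value y) (value x)) eq)
∼-sym {x} {y} (inj₂ (p , pr , eq)) = inj₂ (p , pr ,
  trans (⊔-comm (value y) (value x))
    (trans eq (cong (p *_) (⊓-comm (value x) (value y)))))

∼-irrefl : Irreflexive _≡_ _∼_
∼-irrefl {x} refl (inj₁ eq) with () ← trans (sym (∣n-n∣≡0 (value x))) eq
∼-irrefl {vertex n} refl (inj₂ (p , pr , eq)) = ¬prime[1] (subst Prime p≡1 pr)
  where
  p≡1 : p ≡ 1
  p≡1 = *-cancelʳ-≡ p 1 n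
    (trans (cong (p *_) (sym (⊓-idem n)))
      (trans (sym eq) (trans (⊔-idem n) (sym (*-identityˡ n)))))

module _ {a ℓ} {V : Set a} (_~_ : Rel V ℓ) where

  data Walk : ℕ → V → V → Set (a Level.⊔ ℓ) where
    []  : ∀ {x} → Walk zero x x
    _∷_ : ∀ {n x y z} → x ~ y → Walk n y z → Walk (suc n) x z

  -- Distance as a relation: the minimum length of a walk need not
  -- be computable for an arbitrary adjacency relation.
  IsDistance : V → V → ℕ → Set (a Level.⊔ ℓ)
  IsDistance x y n = Walk n x y × (∀ m → Walk m x y → n ≤ m)

-- d[ x , y ]≡ n reads "d(x, y) = n".
d[_,_]≡_ : Vertex → Vertex → ℕ → Set
d[ x , y ]≡ n = IsDistance _∼_ x y n

{-# OPTIONS --safe #-}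
module Submission where

-- Call a step x ∼ y additive if |x − y| = 1 and multiplicative otherwise, so that
-- a walk alternates between blocks of additive and of multiplicative steps.  Each
-- multiplicative step removes at most one prime factor, while a, b and their
-- neighbours are divisible by high powers of many primes.  If the walk has length
-- at most 5, a single multiplicative block is therefore too short to join the
-- neighbourhoods of a and b.  With two such blocks, some prime whose power divides
-- both ends still divides the numbers on both sides of the additive block in
-- between; these are so close that they coincide, and the two blocks merge.  The
-- remaining shape is × ± × ± ×.  There, parity and the prime 17 force the last
-- vertex before b to be 2b, and 61 or 67, whose cubes divide a and one of 2b ∓ 1,
-- would make the first additive step trivial.
--
-- For a walk of length 6, write b = R c with R prime and choose primes s and q with
-- q (c + 1) = a s + 2; then a, a s, a s + 1, a s + 2, c + 1, c, b is a walk.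

open import Defs

open import Algebra.Properties.CommutativeSemigroup using (x∙yz≈y∙xz)
open import Data.Empty using (⊥)
import Data.Fin.Base as Fin
open import Data.Fin.Properties using (pigeonhole; toℕ-fromℕ<; toℕ<n; toℕ≤n)
open import Data.List.Base using (List; []; _∷_; _++_; length; map; replicate; upTo)
open import Data.List.Membership.Propositional using (_∈_; find)
open import Data.List.Membership.Propositional.Properties using (∈-map⁻; ∈-upTo⁺)
open import Data.List.Properties using (≡-dec)
open import Data.List.Relation.Unary.All as All using (All; []; _∷_; all?)
open import Data.List.Relation.Unary.All.Properties using (map⁺)
open import Data.List.Relation.Unary.Any as Any using (Any; here; there; any?)
import Data.List.Relation.Unary.Any.Properties as Any
open import Data.Nat.Base
open import Data.Nat.Binary.Base using (ℕᵇ; zero; 2[1+_]; 1+[2_]; fromℕ; toℕ)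
open import Data.Nat.Binary.Properties using (toℕ-fromℕ)
open import Data.Nat.Divisibility
open import Data.Nat.DivMod
open import Data.Nat.GCD using (gcd; gcd[m,n]∣m; gcd[m,n]∣n; gcd-GCD; module Bézout)
open import Data.Nat.ListAction using (product)
open import Data.Nat.Primality
open import Data.Nat.Primality.Factorisation
open import Data.Nat.Properties
open import Data.Product.Base using (_×_; _,_; ∃-syntax; ∃₂)
open import Data.Sum.Base as Sum using (_⊎_; inj₁; inj₂; [_,_]′)
open import Function.Base using (_$_; id)
open import Relation.Binary.PropositionalEquality
open import Relation.Nullary
open import Relation.Nullary.Decidable using (True; toWitness; from-yes; _×-dec_; _⊎-dec_; ¬?)

-- Certificates of primality

module Mod (n : ℕ) .{{_ : NonZero n}} where

  infix 4 _≈_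
  _≈_ : ℕ → ℕ → Set
  x ≈ y = x % n ≡ y % n

  %-≈ : ∀ x → x % n ≈ x
  %-≈ x = m%n%n≡m%n x n

  *-cong-≈ : ∀ {x y u v} → x ≈ y → u ≈ v → x * u ≈ y * v
  *-cong-≈ {x} {y} {u} {v} x≈y u≈v =
    trans (%-distribˡ-* x u n)
      (trans (cong₂ (λ s t → (s * t) % n) x≈y u≈v) (sym (%-distribˡ-* y v n)))

  -- Cancelling the common remainder from the division equations of `v` and `suc v` leaves two
  -- multiples of `n` that differ by 1.
  v≈1+v⇒n≡1 : ∀ v → v ≈ suc v → n ≡ 1
  v≈1+v⇒n≡1 v v≈1+v = ∣1⇒≡1 (∣m+n∣m⇒∣n (subst (n ∣_) (sym eq) (n∣m*n (suc v / n))) (n∣m*n (v / n)))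
    where
    open ≡-Reasoning
    eq : v / n * n + 1 ≡ suc v / n * n
    eq = +-cancelˡ-≡ (v % n) _ _ $ begin
      v % n + (v / n * n + 1)       ≡⟨ +-assoc (v % n) _ 1 ⟨
      v % n + v / n * n + 1         ≡⟨ cong (_+ 1) (m≡m%n+[m/n]*n v n) ⟨
      v + 1                         ≡⟨ +-comm v 1 ⟩
      suc v                         ≡⟨ m≡m%n+[m/n]*n (suc v) n ⟩
      suc v % n + suc v / n * n     ≡⟨ cong (_+ suc v / n * n) v≈1+v ⟨
      v % n + suc v / n * n         ∎

  sqMod : ℕ → ℕ
  sqMod x = (x * x) % n

  -- Repeated squaring along zero-free binary digits, where `2[1+ k ]` means 2(1 + k). Reducing at
  -- each squaring keeps the numbers small enough for certificates to be checked by `refl`.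
  powMod : ℕ → ℕᵇ → ℕ
  powMod y zero      = 1
  powMod y 2[1+ k ]  = sqMod (y * powMod y k)
  powMod y 1+[2 k ]  = y * sqMod (powMod y k)

  square-^ : ∀ y k → y ^ k * y ^ k ≡ y ^ (2 * k)
  square-^ y k = trans (sym (^-distribˡ-+-* y k k)) (cong (λ j → y ^ (k + j)) (sym (+-identityʳ k)))

  powMod-≈ : ∀ y k → powMod y k ≈ y ^ toℕ k
  powMod-≈ y zero     = refl
  powMod-≈ y 2[1+ k ] = trans (%-≈ _)
    (trans (*-cong-≈ ih ih) (cong (_% n) (square-^ y (suc (toℕ k)))))
    where ih = *-cong-≈ {y} refl (powMod-≈ y k)
  powMod-≈ y 1+[2 k ] = *-cong-≈ {y} refl (trans (%-≈ _)
    (trans (*-cong-≈ (powMod-≈ y k) (powMod-≈ y k)) (cong (_% n) (square-^ y (toℕ k)))))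

  pow : ℕ → ℕ → ℕ
  pow y k = powMod y (fromℕ k)

  pow-≈ : ∀ y k → pow y k ≈ y ^ k
  pow-≈ y k = trans (powMod-≈ y (fromℕ k)) (cong (λ j → y ^ j % n) (toℕ-fromℕ k))

  module Exponents (y : ℕ) where

    Trivial : ℕ → Set
    Trivial k = y ^ k ≈ 1

    Trivial-+ : ∀ {j k} → Trivial k → y ^ (j + k) ≈ y ^ j
    Trivial-+ {j} {k} t = trans (cong (_% n) (^-distribˡ-+-* y j k))
      (trans (*-cong-≈ {y ^ j} refl t) (cong (_% n) (*-identityʳ (y ^ j))))

    Trivial-* : ∀ c {k} → Trivial k → Trivial (c * k)
    Trivial-* zero    t = refl
    Trivial-* (suc c) {k} t = trans (Trivial-+ {k} (Trivial-* c t)) t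

    -- Bézout's identity with natural coefficients: the gcd plus a multiple of one exponent is a
    -- multiple of the other, and both multiples are trivial.
    Trivial-gcd : ∀ {j k} → Trivial j → Trivial k → Trivial (gcd j k)
    Trivial-gcd {j} {k} tj tk with Bézout.identity (gcd-GCD j k)
    ... | Bézout.+- u v eq = trans (sym (Trivial-+ {gcd j k} (Trivial-* v tk)))
                               (trans (cong (λ e → y ^ e % n) eq) (Trivial-* u tj))
    ... | Bézout.-+ u v eq = trans (sym (Trivial-+ {gcd j k} (Trivial-* u tj)))
                               (trans (cong (λ e → y ^ e % n) eq) (Trivial-* v tk))

    -- Since `y ^ F` is 1, `y ^ (F ∸ i)` is an inverse of `y ^ i`; multiplying the collision by it
    -- cancels `y ^ i`.
    collision⇒Trivial : ∀ {F i j} → Trivial F → i ≤ j → i ≤ F → y ^ i ≈ y ^ j → Trivial (j ∸ i)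
    collision⇒Trivial {F} {i} {j} t i≤j i≤F eq = begin
      y ^ (j ∸ i) % n            ≡⟨ Trivial-+ {j ∸ i} t ⟨
      y ^ (j ∸ i + F) % n        ≡⟨ cong (λ e → y ^ e % n) exponents ⟩
      y ^ (j + (F ∸ i)) % n      ≡⟨ shift j ⟩
      (y ^ j * y ^ (F ∸ i)) % n  ≡⟨ *-cong-≈ eq refl ⟨
      (y ^ i * y ^ (F ∸ i)) % n  ≡⟨ shift i ⟨
      y ^ (i + (F ∸ i)) % n      ≡⟨ cong (λ e → y ^ e % n) (m+[n∸m]≡n i≤F) ⟩
      y ^ F % n                  ≡⟨ t ⟩
      1 % n                      ∎
      where
      open ≡-Reasoning
      shift : ∀ e → y ^ (e + (F ∸ i)) % n ≡ (y ^ e * y ^ (F ∸ i)) % n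
      shift e = cong (_% n) (^-distribˡ-+-* y e (F ∸ i))
      exponents : j ∸ i + F ≡ j + (F ∸ i)
      exponents = trans (+-comm (j ∸ i) F) (trans (sym (+-∸-assoc F i≤j))
        (trans (cong (_∸ i) (+-comm F j)) (+-∸-assoc j i≤F)))

open Mod

primeDivisor : ∀ n .{{_ : NonZero n}} → n ≢ 1 → ∃[ p ] Prime p × p ∣ n
primeDivisor n n≢1 with factorise n
... | record { factors = [] ; isFactorisation = eq } = contradiction eq n≢1
... | record { factors = p ∷ ps ; isFactorisation = eq ; factorsPrime = pr ∷ _ } =
  p , pr , subst (p ∣_) (sym eq) (m∣m*n (product ps))

-- y ^ (F / r) − 1 is a unit modulo N, where r is the prime of isPrime; its
-- inverse v is given by y ^ (F / r) · v ≡ 1 + v, which avoids subtraction.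
record Witness (N y F : ℕ) .{{_ : NonZero N}} : Set where
  constructor witness
  field
    {base}        : ℕ
    isPrime       : Prime base
    cofactor      : ℕ
    inverse       : ℕ
    base*cofactor : base * cofactor ≡ F
    unit          : (pow N y cofactor * inverse) % N ≡ suc inverse % N

open Witness

-- The conditions say that y has order F modulo every divisor d > 1 of N.  Its
-- powers are F distinct residues, so d ≥ F > √N.
pocklington : ∀ N y F .{{_ : NonTrivial N}} .{{_ : NonZero N}} (ws : List (Witness N y F)) →
              product (map base ws) ≡ F → pow N y F % N ≡ 1 % N →
              {True (N <? F * F)} → Prime N
pocklington N y F ws Πws≡F y^F≈1 {N<F²} = rough∧square>⇒prime rough F²>N
  where
  F²>N : F * F > N
  F²>N = toWitness N<F²

  instance
    F≢0 : NonZero F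
    F≢0 = m*n≢0⇒m≢0 F {F} {{>-nonZero (≤-<-trans z≤n F²>N)}}

  module _ {d} .{{_ : NonTrivial d}} (d∣N : d ∣ N) where
    instance
      d≢0 : NonZero d
      d≢0 = nonTrivial⇒nonZero d

    -- Evaluations made once modulo `N` thus serve every divisor `d`.
    reduce : ∀ {x z} → x % N ≡ z % N → x % d ≡ z % d
    reduce {x} {z} eq = trans (sym (m∣n⇒o%n%m≡o%m d N x d∣N))
      (trans (cong (_% d) eq) (m∣n⇒o%n%m≡o%m d N z d∣N))

    open Exponents d y

    Trivial-F : Trivial F
    Trivial-F = reduce (trans (sym (pow-≈ N y F)) y^F≈1)

    -- Otherwise the equation of the witness would read `v ≈ suc v` modulo `d`, forcing `d` = 1.
    ¬Trivial-cofactor : ∀ c → ¬ Trivial (cofactor {N} {y} {F} c)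
    ¬Trivial-cofactor (witness _ k v _ u) t = contradiction
      (v≈1+v⇒n≡1 d v $ begin
         v % d                     ≡⟨ cong (_% d) (*-identityˡ v) ⟨
         (1 * v) % d               ≡⟨ *-cong-≈ d t refl ⟨
         (y ^ k * v) % d           ≡⟨ *-cong-≈ d (reduce (pow-≈ N y k)) refl ⟨
         (pow N y k * v) % d       ≡⟨ reduce u ⟩
         suc v % d                 ∎)
      (nonTrivial⇒≢1 {d})
      where open ≡-Reasoning

    -- Write F = h g with g the gcd of k and F. If h ≠ 1, a prime r dividing h is among the bases,
    -- so F / r is a multiple of g and hence trivial, against its witness.
    F∣Trivial : ∀ {k} → Trivial k → F ∣ k
    F∣Trivial {k} t with gcd[m,n]∣m k F | gcd[m,n]∣n k F
    ... | g∣k | divides h F≡h*g with h ≟ 1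
    ... | yes refl = subst (_∣ k) (trans (sym (*-identityˡ _)) (sym F≡h*g)) g∣k
    ... | no h≢1 with primeDivisor h {{≢-nonZero λ { refl → ≢-nonZero⁻¹ F F≡h*g }}} h≢1
    ... | r , pr , divides h′ h≡h′*r
      with ∈-map⁻ base (factorisationHasAllPrimeFactors pr r∣Π (map⁺ (All.universal isPrime ws)))
      where
      r∣Π : r ∣ product (map base ws)
      r∣Π = subst (r ∣_) (sym (trans Πws≡F F≡h*g)) (∣m⇒∣m*n _ (divides h′ h≡h′*r))
    ... | c , c∈ws , refl = contradiction
      (subst Trivial (sym eq) (Trivial-* h′ {gcd k F} (Trivial-gcd {k} {F} t Trivial-F)))
      (¬Trivial-cofactor c)
      where
      open ≡-Reasoning
      eq : cofactor c ≡ h′ * gcd k F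
      eq = *-cancelˡ-≡ _ _ (base c) {{prime⇒nonZero pr}} $ begin
        base c * cofactor c        ≡⟨ base*cofactor c ⟩
        F                          ≡⟨ F≡h*g ⟩
        h * gcd k F                ≡⟨ cong (_* gcd k F) h≡h′*r ⟩
        h′ * base c * gcd k F      ≡⟨ cong (_* gcd k F) (*-comm h′ (base c)) ⟩
        base c * h′ * gcd k F      ≡⟨ *-assoc (base c) h′ _ ⟩
        base c * (h′ * gcd k F)    ∎

    F≤d : F ≤ d
    F≤d = ≮⇒≥ λ d<F →
      let i , j , i<j , eq = pigeonhole d<F (λ i → (y ^ Fin.toℕ i) mod d)
          t = collision⇒Trivial Trivial-F (<⇒≤ i<j) (toℕ≤n i)
                (trans (sym (toℕ-fromℕ< (m%n<n _ d))) (trans (cong Fin.toℕ eq) (toℕ-fromℕ< (m%n<n _ d))))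
          instance _ = >-nonZero (m<n⇒0<n∸m i<j)
      in <⇒≱ (toℕ<n j) (≤-trans (∣⇒≤ (F∣Trivial {Fin.toℕ j ∸ Fin.toℕ i} t)) (m∸n≤m (Fin.toℕ j) (Fin.toℕ i)))

  rough : F Rough N
  rough (hasNonTrivialDivisor d<F d∣N) = <⇒≱ d<F (F≤d d∣N)

-- Additive and multiplicative steps on natural numbers

infix 4 _±1_ _×÷_

-- Both relations live on all of ℕ, zero included. This can only add walks, so lower bounds carry
-- over to `_∼_`.
_±1_ : ℕ → ℕ → Set
x ±1 y = ∣ x - y ∣ ≡ 1

_×÷_ : ℕ → ℕ → Set
x ×÷ y = ∃[ p ] Prime p × (y ≡ p * x ⊎ x ≡ p * y)

×÷-sym : ∀ {x y} → x ×÷ y → y ×÷ x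
×÷-sym (p , pr , e) = p , pr , Sum.swap e

∼⇒step : ∀ x y → x ∼ y → value x ±1 value y ⊎ value x ×÷ value y
∼⇒step x y (inj₁ e) = inj₁ e
∼⇒step x y (inj₂ (p , pr , e)) with ≤-total (value x) (value y)
... | inj₁ x≤y = inj₂ (p , pr , inj₁ (trans (sym (m≤n⇒m⊔n≡n x≤y)) (trans e (cong (p *_) (m≤n⇒m⊓n≡m x≤y)))))
... | inj₂ y≤x = inj₂ (p , pr , inj₂ (trans (sym (m≥n⇒m⊔n≡m y≤x)) (trans e (cong (p *_) (m≥n⇒m⊓n≡n y≤x)))))

_⊕_ : ∀ {m n} {R : ℕ → ℕ → Set} {x y z} → Walk R m x y → Walk R n y z → Walk R (m + n) x z
[]      ⊕ w = w
(r ∷ v) ⊕ w = r ∷ (v ⊕ w)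

-- Prime factors along multiplicative steps

prime∣prime⇒≡ : ∀ {p q} → Prime p → Prime q → p ∣ q → p ≡ q
prime∣prime⇒≡ pr qr p∣q =
  [ (λ p≡1 → contradiction (subst Prime p≡1 pr) ¬prime[1]) , id ]′ (prime⇒irreducible qr p∣q)

-- Factors P n x says that x is divisible by a product of n primes, repetitions
-- allowed, that satisfy P.
data Factors (P : ℕ → Set) : ℕ → ℕ → Set where
  none : ∀ {x} → Factors P 0 x
  more : ∀ {n p y} → Prime p → P p → Factors P n y → Factors P (suc n) (p * y)

module _ {P : ℕ → Set} where

  Factors-* : ∀ {n x} c → Factors P n x → Factors P n (c * x)
  Factors-* c none = none
  Factors-* c (more {n} {p} {y} pr Pp f) =
    subst (Factors P (suc n)) (x∙yz≈y∙xz *-commutativeSemigroup p c y) (more pr Pp (Factors-* c f))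

  Factors-pred : ∀ {n x} → Factors P (suc n) x → Factors P n x
  Factors-pred (more {p = p} _ _ f) = Factors-* p f

  Factors-≤ : ∀ {m n x} → m ≤ n → Factors P n x → Factors P m x
  Factors-≤ z≤n       f              = none
  Factors-≤ (s≤s m≤n) (more pr Pp f) = more pr Pp (Factors-≤ m≤n f)

  -- Division by `q` costs at most one listed prime: if the first is `q`, it cancels; otherwise
  -- Euclid's lemma finds it in `z`, and the recursion continues on the cofactors.
  Factors-÷ : ∀ {n q x z} → Prime q → x ≡ q * z → Factors P (suc n) x → Factors P n z
  Factors-÷ {zero}  _  _ _ = none
  Factors-÷ {suc n} {q} {_} {z} qr e (more {p = p} {y} pr Pp f) with p ≟ q
  ... | yes refl = subst (Factors P (suc n)) (*-cancelˡ-≡ y z p {{prime⇒nonZero pr}} e) f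
  ... | no p≢q with euclidsLemma q z pr (subst (p ∣_) e (m∣m*n y))
  ... | inj₁ p∣q = contradiction (prime∣prime⇒≡ pr qr p∣q) p≢q
  ... | inj₂ (divides z′ refl) = subst (Factors P (suc n)) (*-comm p z′) (more pr Pp (Factors-÷ qr eq f))
    where
    eq : y ≡ q * z′
    eq = *-cancelˡ-≡ y (q * z′) p {{prime⇒nonZero pr}} (trans e (trans (sym (*-assoc q z′ p)) (*-comm (q * z′) p)))

  Factors-×÷ : ∀ {n x y} → x ×÷ y → Factors P (suc n) x → Factors P n y
  Factors-×÷ (p , pr , inj₁ refl) f = Factors-* p (Factors-pred f)
  Factors-×÷ (p , pr , inj₂ e)    f = Factors-÷ pr e f

  Factors-walk : ∀ {k n x y} → Walk _×÷_ k x y → Factors P (k + n) x → Factors P n y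
  Factors-walk []      f = f
  Factors-walk (r ∷ w) f = Factors-walk w (Factors-×÷ r f)

  Factors-walkʳ : ∀ {k n x y} → Walk _×÷_ k x y → Factors P (k + n) y → Factors P n x
  Factors-walkʳ []      f = f
  Factors-walkʳ {suc k} {n} {y = y} (r ∷ w) f =
    Factors-×÷ (×÷-sym r) (Factors-walkʳ w (subst (λ m → Factors P m y) (sym (+-suc k n)) f))

  Factors⇒∣ : ∀ {n x} → Factors P (suc n) x → ∃[ p ] P p × p ∣ x
  Factors⇒∣ (more {p = p} {y} _ Pp _) = p , Pp , m∣m*n y

  product⇒Factors : ∀ {ps x} → All Prime ps → All P ps → product ps ∣ x → Factors P (length ps) x
  product⇒Factors {ps} prs Pps (divides c refl) = Factors-* c (go prs Pps)
    where
    go : ∀ {ps} → All Prime ps → All P ps → Factors P (length ps) (product ps)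
    go []         []         = none
    go (pr ∷ prs) (Pp ∷ Pps) = more pr Pp (go prs Pps)

-- A certificate against `k` multiplicative steps: each loses at most one listed prime, so one would
-- survive into `y`. Repetitions in the list count multiplicity.
Separates : ℕ → ℕ → ℕ → List ℕ → Set
Separates k x y ps = k < length ps × product ps ∣ x × All (_∤ y) ps × All Prime ps

Separates⇒Factors : ∀ {k x y ps} → Separates k x y ps → Factors (_∤ y) (k + 1) x
Separates⇒Factors {k} (l , d , a , prs) =
  Factors-≤ (≤-trans (≤-reflexive (+-comm k 1)) l) (product⇒Factors prs a d)

¬Factors∤ : ∀ {x} → ¬ Factors (_∤ x) 1 x
¬Factors∤ f with p , p∤x , p∣x ← Factors⇒∣ f = p∤x p∣x

separated⇒¬walk : ∀ {k x y ps} → Separates k x y ps ⊎ Separates k y x ps → ¬ Walk _×÷_ k x y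
separated⇒¬walk (inj₁ s) w = ¬Factors∤ (Factors-walk w (Separates⇒Factors s))
separated⇒¬walk (inj₂ s) w = ¬Factors∤ (Factors-walkʳ w (Separates⇒Factors s))

primePower⇒Factors : ∀ {r} e {x} → Prime r → r ^ e ∣ x → Factors (_≡ r) e x
primePower⇒Factors {r} e pr (divides c refl) = Factors-* c (go e)
  where
  go : ∀ e → Factors (_≡ r) e (r ^ e)
  go zero    = none
  go (suc e) = more pr refl (go e)

∣^⇒∣-walk : ∀ {r k x y} → Prime r → r ^ suc k ∣ x → Walk _×÷_ k x y → r ∣ y
∣^⇒∣-walk {r} {k} {x} pr d w with _ , refl , r∣y ← Factors⇒∣ (Factors-walk w
  (subst (λ m → Factors (_≡ r) m x) (+-comm 1 k) (primePower⇒Factors (suc k) pr d))) = r∣y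

∣^⇒∣-walkʳ : ∀ {r k x y} → Prime r → r ^ suc k ∣ y → Walk _×÷_ k x y → r ∣ x
∣^⇒∣-walkʳ {r} {k} {y = y} pr d w with _ , refl , r∣x ← Factors⇒∣ (Factors-walkʳ w
  (subst (λ m → Factors (_≡ r) m y) (+-comm 1 k) (primePower⇒Factors (suc k) pr d))) = r∣x

-- Closeness along additive steps

walk⇒dist≤ : ∀ {n x y} → Walk _±1_ n x y → ∣ x - y ∣ ≤ n
walk⇒dist≤ {x = x} [] = ≤-reflexive (m≡n⇒∣m-n∣≡0 {x} refl)
walk⇒dist≤ {suc n} {x} {z} (_∷_ {y = y} e w) =
  ≤-trans (∣-∣-triangle x y z) (+-mono-≤ (≤-reflexive e) (walk⇒dist≤ w))

∣-∣-∣ : ∀ {d x y} → d ∣ x → d ∣ y → d ∣ ∣ x - y ∣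
∣-∣-∣ {d} (divides m refl) (divides n refl) = subst (d ∣_) (*-distribʳ-∣-∣ d m n) (n∣m*n ∣ m - n ∣)

close⇒≡ : ∀ {r x y} → r ∣ x → r ∣ y → ∣ x - y ∣ < r → x ≡ y
close⇒≡ {x = x} {y} r∣x r∣y d<r with ∣ x - y ∣ in eq | ∣-∣-∣ r∣x r∣y
... | zero  | _   = ∣m-n∣≡0⇒m≡n eq
... | suc d | r∣d = contradiction (∣⇒≤ r∣d) (<⇒≱ d<r)

±1⇒∤ : ∀ {r x y} → Prime r → x ±1 y → r ∣ x → r ∤ y
±1⇒∤ pr e r∣x r∣y = contradiction (subst Prime (∣1⇒≡1 (subst (_ ∣_) e (∣-∣-∣ r∣x r∣y))) pr) ¬prime[1]

-- Alternating walks

-- n ± k ▸ z consists of n additive steps, then k multiplicative steps, then z.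
data Zigzag : Set where
  ⟨_⟩   : ℕ → Zigzag
  _±_▸_ : ℕ → ℕ → Zigzag → Zigzag

infixr 5 _±_▸_

⟦_⟧ : Zigzag → ℕ → ℕ → Set
⟦ ⟨ n ⟩     ⟧ x y = Walk _±1_ n x y
⟦ n ± k ▸ z ⟧ x y = ∃₂ λ u v → Walk _±1_ n x u × Walk _×÷_ k u v × ⟦ z ⟧ v y

cons± cons× : Zigzag → Zigzag
cons± ⟨ n ⟩       = ⟨ suc n ⟩
cons± (n ± k ▸ z) = suc n ± k ▸ z
cons× (zero ± k ▸ z) = zero ± suc k ▸ z
cons× z              = zero ± 1 ▸ z

cons±-sound : ∀ z {x y t} → x ±1 y → ⟦ z ⟧ y t → ⟦ cons± z ⟧ x t
cons±-sound ⟨ n ⟩       e w                    = e ∷ w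
cons±-sound (n ± k ▸ z) e (u , v , w , w′ , s) = u , v , e ∷ w , w′ , s

cons×-sound : ∀ z {x y t} → x ×÷ y → ⟦ z ⟧ y t → ⟦ cons× z ⟧ x t
cons×-sound ⟨ n ⟩           e w                     = _ , _ , [] , e ∷ [] , w
cons×-sound (zero ± k ▸ z)  e (u , v , [] , w′ , s) = _ , _ , [] , e ∷ w′ , s
cons×-sound (suc n ± k ▸ z) e s                     = _ , _ , [] , e ∷ [] , s

-- One shape for each of the 2^n words in additive and multiplicative steps.
zigzags : ℕ → List Zigzag
zigzags zero    = ⟨ 0 ⟩ ∷ []
zigzags (suc n) = map cons± (zigzags n) ++ map cons× (zigzags n)

walk⇒zigzag : ∀ {n x y} → Walk _∼_ n x y → Any (λ z → ⟦ z ⟧ (value x) (value y)) (zigzags n)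
walk⇒zigzag [] = here []
walk⇒zigzag {suc n} (_∷_ {x = x} {y} e w) with ∼⇒step x y e
... | inj₁ a = Any.++⁺ˡ (Any.map⁺ (Any.map (λ {z} → cons±-sound z a) (walk⇒zigzag w)))
... | inj₂ m = Any.++⁺ʳ (map cons± (zigzags n)) (Any.map⁺ (Any.map (λ {z} → cons×-sound z m) (walk⇒zigzag w)))

-- Obstructions that can be tested by evaluation

ball : ℕ → ℕ → List ℕ
ball zero    c = c ∷ []
ball (suc n) c = suc n + c ∷ c ∸ suc n ∷ ball n c

∈-ball : ∀ n {x c} → ∣ x - c ∣ ≤ n → x ∈ ball n c
∈-ball zero    d≤0 = here (∣m-n∣≡0⇒m≡n (n≤0⇒n≡0 d≤0))
∈-ball (suc n) {x} {c} d≤n with m≤n⇒m<n∨m≡n d≤n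
... | inj₁ d<n = there (there (∈-ball n (s≤s⁻¹ d<n)))
... | inj₂ d≡n with ≤-total x c
... | inj₁ x≤c = there (here (trans (sym (m∸[m∸n]≡n x≤c))
                   (cong (c ∸_) (trans (sym (m≤n⇒∣m-n∣≡n∸m x≤c)) d≡n))))
... | inj₂ c≤x = here (trans (sym (m∸n+n≡m c≤x))
                   (cong (_+ c) (trans (sym (m≤n⇒∣m-n∣≡n∸m c≤x)) (trans (∣-∣-comm c x) d≡n))))

Separated : ℕ → ℕ → ℕ → List (List ℕ) → Set
Separated k x y = Any (λ ps → Separates k x y ps ⊎ Separates k y x ps)

-- The exponent lets `r` survive `i` multiplicative steps from `x` and `j` from `y`. The ends of the
-- `n` additive steps in between are then multiples of `r` less than `r` apart.
Bridge : ℕ → ℕ → ℕ → ℕ → ℕ → ℕ × ℕ → Set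
Bridge i n j x y (r , e) = n < r × i < e × j < e × r ^ e ∣ x × r ^ e ∣ y × Prime r

bridge? : ∀ i n j x y re → Dec (Bridge i n j x y re)
bridge? i n j x y (r , e) = n <? r ×-dec i <? e ×-dec j <? e
  ×-dec r ^ e ∣? x ×-dec r ^ e ∣? y ×-dec prime? r

^-mono-∣ : ∀ r {i e} → i ≤ e → r ^ i ∣ r ^ e
^-mono-∣ r {i} {e} i≤e = divides (r ^ (e ∸ i))
  (trans (cong (r ^_) (sym (m∸n+n≡m i≤e))) (^-distribˡ-+-* r (e ∸ i) i))

bridge⇒≡ : ∀ {i n j x u v y re} → Bridge i n j x y re →
           Walk _×÷_ i x u → Walk _±1_ n u v → Walk _×÷_ j v y → u ≡ v
bridge⇒≡ {re = r , _} (n<r , i<e , j<e , dˡ , dʳ , pr) w s w′ =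
  close⇒≡ (∣^⇒∣-walk pr (∣-trans (^-mono-∣ r i<e) dˡ) w)
          (∣^⇒∣-walkʳ pr (∣-trans (^-mono-∣ r j<e) dʳ) w′)
          (≤-<-trans (walk⇒dist≤ s) n<r)

-- Parity and the shape × ± × ± ×

even⊎odd : ∀ n → 2 ∣ n ⊎ 2 ∣ suc n
even⊎odd zero    = inj₁ (2 ∣0)
even⊎odd (suc n) with even⊎odd n
... | inj₁ d = inj₂ (∣m∣n⇒∣m+n ∣-refl d)
... | inj₂ d = inj₁ d

±1⇒≡ : ∀ {x y} → x ±1 y → x ≡ suc y ⊎ y ≡ suc x
±1⇒≡ {zero}  {suc y} refl = inj₂ refl
±1⇒≡ {suc x} {zero}  refl = inj₁ refl
±1⇒≡ {suc x} {suc y} e    = Sum.map (cong suc) (cong suc) (±1⇒≡ {x} e)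

±1-sym : ∀ {x y} → x ±1 y → y ±1 x
±1-sym {x} {y} = trans (∣-∣-comm y x)

±1⇒even : ∀ {x y} → x ±1 y → 2 ∤ x → 2 ∣ y
±1⇒even {x} {y} e 2∤x with ±1⇒≡ {x} {y} e
... | inj₁ refl = [ id , (λ d → contradiction d 2∤x) ]′ (even⊎odd y)
... | inj₂ refl = [ (λ d → contradiction d 2∤x) , id ]′ (even⊎odd x)

-- The conditions excluding the shape × ± × ± ×.
record Singular (a b : ℕ) : Set where
  field
    {r}  : ℕ
    {rs} : List (ℕ × ℕ)
    4∣a  : 2 ^ 2 ∣ a
    2∤b  : 2 ∤ b
    r-prime : Prime r
    3<r  : 3 < r
    r²∣a : r ^ 2 ∣ a
    r²∣b : r ^ 2 ∣ b
    bridge⁻ : Any (Bridge 1 1 1 a (pred (2 * b))) rs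
    bridge⁺ : Any (Bridge 1 1 1 a (suc (2 * b))) rs

¬±1-refl : ∀ {x} → ¬ x ±1 x
¬±1-refl {x} e with () ← trans (sym (m≡n⇒∣m-n∣≡0 {x} refl)) e

-- The walk reads a, x, y, z, w, b. Here `x` is even, `y` and `z` are odd and `w` is even; as `b` is
-- odd, the last step must be a division by 2.
singular⇒¬zigzag : ∀ {a b} → Singular a b → ¬ ⟦ 0 ± 1 ▸ 1 ± 1 ▸ 1 ± 1 ▸ ⟨ 0 ⟩ ⟧ a b
singular⇒¬zigzag {a} {b} S
  (_ , x , [] , ax , y , z , xy@(x±y ∷ []) , yz@((q , qr , e) ∷ []) , w , _ , z±w ∷ [] , wb@((s , sr , e′) ∷ []) , [])
  with ±1⇒≡ {z} {2 * b} (subst (z ±1_) w≡2b z±w)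
  where
  open Singular S
  2∤y : 2 ∤ y
  2∤y = ±1⇒∤ prime[2] x±y (∣^⇒∣-walk prime[2] 4∣a ax)
  r∣x : r ∣ x
  r∣x = ∣^⇒∣-walk r-prime r²∣a ax
  r∣w : r ∣ w
  r∣w = ∣^⇒∣-walkʳ r-prime r²∣b wb
  -- If z = 2y, then 2x and `w` are multiples of `r` at most 2 + 1 = 3 apart, hence equal; but then
  -- `z` and `w` differ by 2, not 1.
  z≢2y : z ≢ 2 * y
  z≢2y refl = contradiction (trans (sym z±w) (trans (cong (∣ 2 * y -_∣) (sym 2x≡w))
    (trans (sym (*-distribˡ-∣-∣ 2 y x)) (cong (2 *_) (±1-sym {x} x±y))))) λ ()
    where
    2x≡w : 2 * x ≡ w
    2x≡w = close⇒≡ (∣n⇒∣m*n 2 r∣x) r∣w (≤-<-trans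
      (≤-trans (∣-∣-triangle (2 * x) (2 * y) w)
        (≤-reflexive (cong₂ _+_ (trans (sym (*-distribˡ-∣-∣ 2 x y)) (cong (2 *_) x±y)) z±w)))
      3<r)
  -- An even `z` could arise from the odd `y` only through `q` = 2, the case just excluded.
  2∤z : z ≡ q * y ⊎ y ≡ q * z → 2 ∤ z
  2∤z (inj₂ y≡qz) 2∣z = 2∤y (subst (2 ∣_) (sym y≡qz) (∣n⇒∣m*n q 2∣z))
  2∤z (inj₁ z≡qy) 2∣z with euclidsLemma q y prime[2] (subst (2 ∣_) z≡qy 2∣z)
  ... | inj₁ 2∣q = z≢2y (trans z≡qy (cong (_* y) (sym (prime∣prime⇒≡ prime[2] qr 2∣q))))
  ... | inj₂ 2∣y = 2∤y 2∣y
  2∣w : 2 ∣ w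
  2∣w = ±1⇒even {z} z±w (2∤z e)
  w-multiple : b ≡ s * w ⊎ w ≡ s * b → w ≡ 2 * b
  w-multiple (inj₁ b≡sw) = contradiction (subst (2 ∣_) (sym b≡sw) (∣n⇒∣m*n s 2∣w)) 2∤b
  w-multiple (inj₂ w≡sb) with euclidsLemma s b prime[2] (subst (2 ∣_) w≡sb 2∣w)
  ... | inj₁ 2∣s = trans w≡sb (cong (_* b) (sym (prime∣prime⇒≡ prime[2] sr 2∣s)))
  ... | inj₂ 2∣b = contradiction 2∣b 2∤b
  w≡2b : w ≡ 2 * b
  w≡2b = w-multiple e′
... | inj₁ refl with _ , _ , β ← find (Singular.bridge⁺ S) =
  ¬±1-refl {x} (subst (x ±1_) (sym (bridge⇒≡ β ax xy yz)) x±y)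
... | inj₂ 2b≡1+z with re , _ , β ← find (Singular.bridge⁻ S) =
  ¬±1-refl {x} (subst (x ±1_) (sym (bridge⇒≡ (subst (λ t → Bridge 1 1 1 a (pred t) re) 2b≡1+z β) ax xy yz)) x±y)

-- Testing every shape of a given length

module _ (separators : List (List ℕ)) (bridges : List (ℕ × ℕ)) (a b : ℕ) where

  -- Three multiplicative blocks already take 5 steps, so in shorter or equal length only × ± × ± ×
  -- occurs with three; four blocks would take at least 7.
  Blocked : Zigzag → Set
  Blocked ⟨ n ⟩ = All (λ x → Separated 0 x b separators) (ball n a)
  Blocked (n ± k ▸ ⟨ m ⟩) =
    All (λ x → All (λ y → Separated k x y separators) (ball m b)) (ball n a)
  Blocked (n ± i ▸ l ± j ▸ ⟨ m ⟩) =
    All (λ x → All (λ y → Separated (i + j) x y separators × Any (Bridge i l j x y) bridges) (ball m b)) (ball n a)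
  Blocked (n ± i ▸ l ± j ▸ m ± k ▸ ⟨ o ⟩) =
    _≡_ {A = List ℕ} (n ∷ i ∷ l ∷ j ∷ m ∷ k ∷ o ∷ []) (0 ∷ 1 ∷ 1 ∷ 1 ∷ 1 ∷ 1 ∷ 0 ∷ [])
  Blocked (_ ± _ ▸ _ ± _ ▸ _ ± _ ▸ _ ± _ ▸ _) = ⊥

  separated⇒¬walks : ∀ {k x y} → Separated k x y separators → ¬ Walk _×÷_ k x y
  separated⇒¬walks σs with _ , _ , σ ← find σs = separated⇒¬walk σ

  ∈-ball-walk : ∀ {n x} → Walk _±1_ n a x → x ∈ ball n a
  ∈-ball-walk {n} {x} w = ∈-ball n (≤-trans (≤-reflexive (∣-∣-comm x a)) (walk⇒dist≤ w))

  ∈-ball-walkʳ : ∀ {n x} → Walk _±1_ n x b → x ∈ ball n b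
  ∈-ball-walkʳ {n} w = ∈-ball n (walk⇒dist≤ w)

  blocked⇒¬zigzag : Singular a b → ∀ z → Blocked z → ¬ ⟦ z ⟧ a b
  blocked⇒¬zigzag S ⟨ n ⟩ B w = separated⇒¬walks (All.lookup B (∈-ball-walk w)) []
  blocked⇒¬zigzag S (n ± k ▸ ⟨ m ⟩) B (x , y , w , s , w′) =
    separated⇒¬walks (All.lookup (All.lookup B (∈-ball-walk w)) (∈-ball-walkʳ w′)) s
  blocked⇒¬zigzag S (n ± i ▸ l ± j ▸ ⟨ m ⟩) B (x , u , w , s , v , y , w′ , s′ , w″)
    with σ , βs ← All.lookup (All.lookup B (∈-ball-walk w)) (∈-ball-walkʳ w″)
    with _ , _ , β ← find βs
    with refl ← bridge⇒≡ β s w′ s′ = separated⇒¬walks σ (s ⊕ s′)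
  blocked⇒¬zigzag S (n ± i ▸ l ± j ▸ m ± k ▸ ⟨ o ⟩) refl = singular⇒¬zigzag S

  separated? : ∀ k x y → Dec (Separated k x y separators)
  separated? k x y = any? (λ ps → separates? x y ps ⊎-dec separates? y x ps) separators
    where
    separates? : ∀ x y ps → Dec (Separates k x y ps)
    separates? x y ps = k <? length ps ×-dec product ps ∣? x
      ×-dec all? (λ p → ¬? (p ∣? y)) ps ×-dec all? prime? ps

  blocked? : ∀ z → Dec (Blocked z)
  blocked? ⟨ n ⟩ = all? (λ x → separated? 0 x b) (ball n a)
  blocked? (n ± k ▸ ⟨ m ⟩) = all? (λ x → all? (separated? k x) (ball m b)) (ball n a)
  blocked? (n ± i ▸ l ± j ▸ ⟨ m ⟩) =
    all? (λ x → all? (λ y → separated? (i + j) x y ×-dec any? (bridge? i l j x y) bridges) (ball m b)) (ball n a)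
  blocked? (n ± i ▸ l ± j ▸ m ± k ▸ ⟨ o ⟩) = ≡-dec _≟_ _ _
  blocked? (_ ± _ ▸ _ ± _ ▸ _ ± _ ▸ _ ± _ ▸ _) = no λ ()

blocked⇒d≥ : ∀ seps brs {x y} N → let a = value x ; b = value y in Singular a b →
  All (λ n → All (Blocked seps brs a b) (zigzags n)) (upTo N) →
  ∀ m → Walk _∼_ m x y → N ≤ m
blocked⇒d≥ seps brs {x} {y} N S B m w = ≮⇒≥ λ m<N →
  let z , z∈ , p = find (walk⇒zigzag w)
  in blocked⇒¬zigzag seps brs (value x) (value y) S z (All.lookup (All.lookup B (∈-upTo⁺ m<N)) z∈) p

-- A walk of length 6 from a linear equation

increment : ∀ x y → value y ≡ suc (value x) → x ∼ y
increment x y eq = inj₁ (trans (cong ∣ value x -_∣ eq) (∣n-1+n∣≡1 (value x)))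
  where
  ∣n-1+n∣≡1 : ∀ n → ∣ n - suc n ∣ ≡ 1
  ∣n-1+n∣≡1 n = trans (m≤n⇒∣m-n∣≡n∸m (n≤1+n n)) (m+n∸n≡m 1 n)

multiply : ∀ x y {p} → Prime p → value y ≡ p * value x → x ∼ y
multiply x y {p} pr eq = inj₂ (p , pr , trans (m≤n⇒m⊔n≡n x≤y) (trans eq (cong (p *_) (sym (m≤n⇒m⊓n≡m x≤y)))))
  where
  x≤y : value x ≤ value y
  x≤y = ≤-trans (m≤n*m (value x) p {{prime⇒nonZero pr}}) (≤-reflexive (sym eq))

decrement : ∀ x y → value x ≡ suc (value y) → x ∼ y
decrement x y eq = ∼-sym {y} {x} (increment y x eq)

divide : ∀ x y {p} → Prime p → value x ≡ p * value y → x ∼ y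
divide x y pr eq = ∼-sym {y} {x} (multiply y x pr eq)

linear⇒walk₆ : ∀ x y z {s q r} → Prime s → Prime q → Prime r →
               q * suc (value z) ≡ 2 + s * value x → value y ≡ r * value z →
               Walk _∼_ 6 x y
linear⇒walk₆ x@(vertex n {{n≢0}}) y z {s} s-prime q-prime r-prime eq eq′ =
    _∷_ {y = sx} (multiply x sx s-prime refl) (
    increment sx 1+sx refl
  ∷ increment 1+sx 2+sx refl
  ∷ divide 2+sx 1+z q-prime (sym eq)
  ∷ _∷_ {y = z} (decrement 1+z z refl) (multiply z y r-prime eq′ ∷ []))
  where
  sx 1+sx 2+sx 1+z : Vertex
  sx   = vertex (s * n) {{m*n≢0 s n {{prime⇒nonZero s-prime}} {{n≢0}}}}
  1+sx = vertex (1 + s * n)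
  2+sx = vertex (2 + s * n)
  1+z  = vertex (suc (value z))

-- The walk of length 6, and the tables excluding shorter ones

smallPrime : ∀ p {p-prime : True (prime? p)} → Prime p
smallPrime p {p-prime} = toWitness p-prime

-- A prime factor of `b`; the last step of the walk multiplies `c` by it.
R : ℕ
R = 3002788480280130715907572988323

prime-R : Prime R
prime-R = pocklington R
    64
    500464746713355119317928831387
    ( witness
        -- Here `F` is itself prime: it is the only base, with cofactor 1, and is certified
        -- recursively.
        (pocklington 500464746713355119317928831387
          208510282921461519347308716635
          65283687283244862942594421
          ( witness
              (pocklington 65283687283244862942594421
                37495103671454896073203647
                12066208027369
                ( witness (smallPrime 733) 16461402493 18206455852554716031816857 refl refl
                ∷ witness
                    (pocklington 16461402493
                      5492632903
                      5215907
                      ( witness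
                          (pocklington 5215907
                            3887433
                            153409
                            ( witness
                                (pocklington 153409
                                  55126
                                  799
                                  ( witness (smallPrime 17) 47 71590 refl refl
                                  ∷ witness (smallPrime 47) 17 59267 refl refl
                                  ∷ []) refl refl)
                                1 2245289 refl refl
                            ∷ []) refl refl)
                          1 11031201600 refl refl
                      ∷ []) refl refl)
                    733 61192514277098738991242882 refl refl
                ∷ []) refl refl)
              1 174672843085974311095079681355 refl refl
          ∷ []) refl refl)
        1 1382235967113076043830470105736 refl refl
    ∷ []) refl refl

-- s and q solve the linear congruence behind linear⇒walk₆; the solutions
-- form an arithmetic progression, in which both are prime for this choice.
s : ℕ
s = 1574436225274626108307300501890023090565832751240353786767240371

prime-s : Prime s
prime-s = pocklington s
    1453353081449759609300768723896361209602806162353959036370397493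
    871058945102257070150698622415259
    ( witness (smallPrime 241) 3614352469303971245438583495499 601360111961807164816302759600534617963862004814201801087636367 refl refl
    ∷ witness
        (pocklington 21248207
          12128104
          5363
          ( witness (smallPrime 31) 173 511614 refl refl
          ∷ witness (smallPrime 173) 31 12788570 refl refl
          ∷ []) refl refl)
        40994468149818809189438837 493310265561615057615177710991458046847568764575760514011491457 refl refl
    ∷ witness
        (pocklington 170101527592609166761157
          138099034880620749692335
          6403460608063889729
          ( witness
              (pocklington 6403460608063889729
                4749849291120119814
                4826143717
                ( witness (smallPrime 311) 15518147 1965035802023606028 refl refl
                ∷ witness (smallPrime 1013) 4764209 3115849439898110078 refl refl
                ∷ witness (smallPrime 15319) 315043 1740789196044388307 refl refl
                ∷ []) refl refl)
              1 29288754813164156389711 refl refl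
          ∷ []) refl refl)
        5120817887 2194889966749223522986610912345580438873219993843889345815409 refl refl
    ∷ []) refl refl

q : ℕ
q = 5369083940204905468420170055068713683538256862351539057352121391469046728337153079306079228529

prime-q : Prime q
prime-q = pocklington q
    3195473284078200645179674542505551405017743841380741603013529882121074386641251475077503345204
    46390035063068253651839823485511412232793228325051103906179659078828118840280328286199
    ( witness
        (pocklington 46390035063068253651839823485511412232793228325051103906179659078828118840280328286199
          19212109382244071129269945701756443495856559150268772324907888781439808299035535781080
          2527373825929022846898135568426556400977742211457
          ( witness
              (pocklington 2527373825929022846898135568426556400977742211457
                1704668470593176401295998483480227162532538492108
                64584702167388195748572017
                ( witness
                    (pocklington 64584702167388195748572017
                      14060107520642703061879590
                      525925491655607
                      ( witness
                          (pocklington 525925491655607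
                            30802184406351
                            39977434
                            ( witness (smallPrime 2) 19988717 262962745827803 refl refl
                            ∷ witness (smallPrime 7) 5711062 31247439098670 refl refl
                            -- The prime 7 is listed twice because the bases must multiply to `F`,
                            -- which 49 divides.
                            ∷ witness (smallPrime 7) 5711062 31247439098670 refl refl
                            ∷ witness (smallPrime 503) 79478 211084152601085 refl refl
                            ∷ witness (smallPrime 811) 49294 199065087159138 refl refl
                            ∷ []) refl refl)
                          1 59939588435741800409945607 refl refl
                      ∷ []) refl refl)
                    1 328563436140819537261061470277491773745995191087 refl refl
                ∷ []) refl refl)
              1 16297192246619801299738700450555040805528798858075940264439321083441307942897717351540 refl refl
          ∷ []) refl refl)
        1 2483255650508866293710572222333849864504721361846084677707942504115141598907633607411397180350 refl refl
    ∷ []) refl refl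

a b c : ℕ
a = 78771396447102712858983060028364040588200363965800348300294278460171184936676238386812500
b = 69361450337373409253643736115520077769719726556245843055209221317850552454692640951093751
c = b / R

-- A list must be longer than the number of multiplicative steps it excludes: cubes serve for up to
-- two, the joined cubes of 11 and 53 for up to five. The power 5^6 divides `a` while 5 does not
-- divide `b`, which excludes five steps between them.
separators : List (List ℕ)
separators = replicate 5 3 ∷ replicate 6 5 ∷ replicate 4 59 ∷ cube 7 ∷ cube 11 ∷
  (cube 11 ++ cube 53) ∷ cube 19 ∷ cube 23 ∷ []
  where
  cube : ℕ → List ℕ
  cube = replicate 3

bridges : List (ℕ × ℕ)
-- Two-block shapes with a block of three steps have lengths 3, 1, 1 or 1, 1, 3 and run from `a` to
-- `b` themselves; they need an exponent above 3, which 3^5 supplies. Cubes serve for blocks of at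
-- most two steps.
bridges = (3 , 5) ∷ map (_, 3)
  (5 ∷ 7 ∷ 11 ∷ 13 ∷ 17 ∷ 19 ∷ 23 ∷ 29 ∷ 31 ∷ 43 ∷ 47 ∷ 53 ∷ 59 ∷ 61 ∷ 67 ∷ [])

singular-ab : Singular a b
singular-ab = record
  { 4∣a     = from-yes (2 ^ 2 ∣? a)
  ; 2∤b     = from-yes (¬? (2 ∣? b))
  ; r-prime = smallPrime 17
  ; 3<r     = from-yes (3 <? 17)
  ; r²∣a    = from-yes (17 ^ 2 ∣? a)
  ; r²∣b    = from-yes (17 ^ 2 ∣? b)
  ; bridge⁻ = from-yes (any? (bridge? 1 1 1 a (pred (2 * b))) bridges)
  ; bridge⁺ = from-yes (any? (bridge? 1 1 1 a (suc (2 * b))) bridges)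
  }

proposition3p1 : d[ vertex 78771396447102712858983060028364040588200363965800348300294278460171184936676238386812500
    , vertex 69361450337373409253643736115520077769719726556245843055209221317850552454692640951093751
    ]≡ 6
proposition3p1 =
    linear⇒walk₆ (vertex a) (vertex b) (vertex c) prime-s prime-q prime-R refl refl
  , blocked⇒d≥ separators bridges 6 singular-ab
      -- Evaluation checks all 1 + 2 + 4 + 8 + 16 + 32 = 63 shapes of fewer than six steps.
      (from-yes (all? (λ n → all? (blocked? separators bridges a b) (zigzags n)) (upTo 6)))
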